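{- (i) If $G$ is a partial cube and $G'$ is an expansion of $G$, then $G'$ is a partial cube. (ii) If $G'$ is a partial cube and $G$ is a contraction of $G'$, then $G$ is a partial cube.
   Context: Graphs are simple, undirected, nonempty, and not necessarily finite. For a set $X$, the hypercube $\mathcal H(X)$ is the graph whose vertices are the finite subsets of $X$, with $P,Q$ adjacent iff $|P\Delta Q|=1$. A graph is a partial cube if it can be isometrically embedded (i.e. by a map preserving shortest-path distances) into some $\mathcal H(X)$. A subgraph $H$ of a connected graph $G$ is isometric if $d_H(a,b)=d_G(a,b)$ for all vertices $a,b$ of $H$. Expansion: let $G=(V,E)$ be a connected graph and let $G_1=(V_1,E_1)$, $G_2=(V_2,E_2)$ be two (nonempty) isometric subgraphs of $G$ with $G=G_1\cup G_2$ (i.e. $V=V_1\cup V_2$, $E=E_1\cup E_2$). The expansion of $G$ with respect to $G_1$ and $G_2$ is the graph $G'$ with vertex set $V'_1\cup V'_2$, where $V'_i=\{x^i=(i,x):x\in V_i\}$, whose edges are $x^iy^i$ for $xy\in E_i$ ($i=1,2$) together with the edges $x^1x^2$ for $x\in V_1\cap V_2$. In this case $G$ is called a contraction of $G'$ (expansions and contractions are taken up to isomorphism). -}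

-- Sets are setoids throughout, since equality of (finite) subsets is
-- extensional.
module Defs where

open import Level using (Level; suc)
open import Data.Bool using (Bool; true; false; T; _xor_)
open import Data.Bool.Properties using (xor-comm; xor-same)
open import Data.Fin using (Fin; zero)
open import Data.Nat as ℕ using (ℕ; _≤_)
open import Data.Product using (Σ; Σ-syntax; ∃; _×_; _,_; proj₁; proj₂)
open import Data.Sum using (_⊎_; inj₁; inj₂)
open import Data.Sum.Relation.Binary.Pointwise using (_⊎ₛ_; inj₁; inj₂)
open import Function.Base using (_on_)
open import Function.Bundles using (Func; Inverse; _⇔_; _⟨$⟩_)
open import Function.Construct.Composition using (inverse)
open import Function.Relation.Binary.Setoid.Equality using (_⇨_)
open import Relation.Binary.Bundles using (Setoid)
open import Relation.Binary.Core using (Rel; _⇒_)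
open import Relation.Binary.Definitions
  using (Symmetric; Irreflexive; _Respects_; _Respects₂_)
import Relation.Binary.Construct.On as On
open import Relation.Binary.PropositionalEquality as ≡ using (_≡_)
open import Relation.Unary using (Pred)

private
  variable
    ℓ : Level

record Graph (ℓ : Level) : Set (suc ℓ) where
  field
    vertices : Setoid ℓ ℓ

  open Setoid vertices public renaming (Carrier to V)

  infix 4 _~_
  field
    nonempty : V
    _~_      : Rel V ℓ
    ~-resp   : _~_ Respects₂ _≈_
    ~-sym    : Symmetric _~_
    ~-irrefl : Irreflexive _≈_ _~_

open Graph using (V; vertices)

data Walk (G : Graph ℓ) : ℕ → V G → V G → Set ℓ where
  stop : ∀ {x y} → Graph._≈_ G x y → Walk G 0 x y
  step : ∀ {n x y z} → Graph._~_ G x y → Walk G n y z → Walk G (ℕ.suc n) x z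

Connected : Graph ℓ → Set ℓ
Connected G = ∀ x y → ∃ λ n → Walk G n x y

-- IsDistance G x y n says d(x , y) = n.  It holds for no n when x and y lie
-- in different components, i.e. when d(x , y) = ∞.
IsDistance : (G : Graph ℓ) → V G → V G → ℕ → Set ℓ
IsDistance G x y n = Walk G n x y × (∀ m → Walk G m x y → n ≤ m)

-- The equivalence for all n covers d = ∞ as well.
IsIsometric : (G H : Graph ℓ) → Func (vertices G) (vertices H) → Set ℓ
IsIsometric G H f =
  ∀ x y n → IsDistance G x y n ⇔ IsDistance H (f ⟨$⟩ x) (f ⟨$⟩ y) n

-- Subsets are given by characteristic functions.  This costs no finite subset
-- classically, and it makes the symmetric difference of finite subsets finite
-- even when equality on X is not decidable.
module _ (X : Setoid ℓ ℓ) where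

  Subset : Set ℓ
  Subset = Func X (≡.setoid Bool)

  ∅ : Subset
  ∅ = record { to = λ _ → false ; cong = λ _ → ≡.refl }

module _ {X : Setoid ℓ ℓ} where
  private
    module X = Setoid X

  open Setoid (X ⇨ ≡.setoid Bool) public using () renaming (_≈_ to _≐_)

  Elements : Subset X → Setoid ℓ ℓ
  Elements P = On.setoid X (proj₁ {B = λ x → T (P ⟨$⟩ x)})

  HasSize : Subset X → ℕ → Set ℓ
  HasSize P n = Inverse (≡.setoid (Fin n)) (Elements P)

  IsFinite : Subset X → Set ℓ
  IsFinite P = ∃ λ n → HasSize P n

  _Δ_ : Subset X → Subset X → Subset X
  P Δ Q = record
    { to   = λ x → (P ⟨$⟩ x) xor (Q ⟨$⟩ x)
    ; cong = λ x≈y → ≡.cong₂ _xor_ (Func.cong P x≈y) (Func.cong Q x≈y)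
    }

  HasSize-resp : ∀ {P Q n} → P ≐ Q → HasSize P n → HasSize Q n
  HasSize-resp {P} {Q} P≐Q s = inverse s record
    { to        = λ (x , p) → x , ≡.subst T (P≐Q x) p
    ; from      = λ (x , q) → x , ≡.subst T (≡.sym (P≐Q x)) q
    ; to-cong   = λ e → e
    ; from-cong = λ e → e
    ; inverse   = (λ e → e) , (λ e → e)
    }

FiniteSubset : Setoid ℓ ℓ → Set ℓ
FiniteSubset X = Σ[ P ∈ Subset X ] IsFinite P

Hypercube : Setoid ℓ ℓ → Graph ℓ
Hypercube X = record
  { vertices = On.setoid (X ⇨ ≡.setoid Bool) (proj₁ {B = IsFinite})
  ; nonempty = ∅ X , 0 , record
      { to        = λ ()
      ; from      = λ ()
      ; to-cong   = λ { {()} }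
      ; from-cong = λ { {_ , ()} }
      ; inverse   = (λ { {_ , ()} }) , λ { {()} }
      }
  ; _~_      = λ (P , _) (Q , _) → HasSize (P Δ Q) 1
  ; ~-resp   =
      (λ {(P , _)} {(Q , _)} {(R , _)} Q≐R →
        HasSize-resp {P = P Δ Q} {P Δ R}
          (λ x → ≡.cong ((P ⟨$⟩ x) xor_) (Q≐R x)))
    , (λ {(P , _)} {(Q , _)} {(R , _)} Q≐R →
        HasSize-resp {P = Q Δ P} {R Δ P}
          (λ x → ≡.cong (_xor (P ⟨$⟩ x)) (Q≐R x)))
  ; ~-sym    = λ {(P , _)} {(Q , _)} →
      HasSize-resp {P = P Δ Q} {Q Δ P}
        (λ x → xor-comm (P ⟨$⟩ x) (Q ⟨$⟩ x))
  ; ~-irrefl = λ {(P , _)} {(Q , _)} P≐Q s →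
      let (x , x∈PΔQ) = Inverse.to s zero in
      ≡.subst T
        (≡.trans (≡.cong (_xor (Q ⟨$⟩ x)) (P≐Q x)) (xor-same (Q ⟨$⟩ x)))
        x∈PΔQ
  }

IsPartialCube : Graph ℓ → Set (suc ℓ)
IsPartialCube {ℓ} G =
  Σ[ X ∈ Setoid ℓ ℓ ]
  Σ[ f ∈ Func (vertices G) (vertices (Hypercube X)) ]
  IsIsometric G (Hypercube X) f

record Subgraph (G : Graph ℓ) : Set (suc ℓ) where
  private
    module G = Graph G
  field
    InV      : Pred G.V ℓ
    InE      : Rel G.V ℓ
    InV-resp : InV Respects G._≈_
    InE-resp : InE Respects₂ G._≈_
    InE-sym  : Symmetric InE
    InE⇒~    : InE ⇒ G._~_
    source   : ∀ {x y} → InE x y → InV x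
    nonempty : ∃ InV

  target : ∀ {x y} → InE x y → InV y
  target e = source (InE-sym e)

  graph : Graph ℓ
  graph = record
    { vertices = On.setoid G.vertices (proj₁ {B = InV})
    ; nonempty = nonempty
    ; _~_      = InE on proj₁
    ; ~-resp   = proj₁ InE-resp , proj₂ InE-resp
    ; ~-sym    = InE-sym
    ; ~-irrefl = λ x≈y e → G.~-irrefl x≈y (InE⇒~ e)
    }

  inclusion : Func (vertices graph) G.vertices
  inclusion = record { to = proj₁ ; cong = λ x≈y → x≈y }

  Isometric : Set ℓ
  Isometric = IsIsometric graph G inclusion

IsUnion : (G : Graph ℓ) → Subgraph G → Subgraph G → Set ℓ
IsUnion G G₁ G₂ =
    (∀ x → InV G₁ x ⊎ InV G₂ x)
  × (∀ x y → Graph._~_ G x y → InE G₁ x y ⊎ InE G₂ x y)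
  where open Subgraph

module _ (G : Graph ℓ) (G₁ G₂ : Subgraph G) where
  private
    module G  = Graph G
    module G₁ = Subgraph G₁
    module G₂ = Subgraph G₂
    W = Setoid.Carrier (vertices G₁.graph ⊎ₛ vertices G₂.graph)

  -- An edge between the copies joins x¹ to y² when x and y are the same
  -- vertex of G, which then lies in V₁ ∩ V₂.
  ExpansionAdj : Rel W ℓ
  ExpansionAdj (inj₁ (x , _)) (inj₁ (y , _)) = G₁.InE x y
  ExpansionAdj (inj₁ (x , _)) (inj₂ (y , _)) = x G.≈ y
  ExpansionAdj (inj₂ (x , _)) (inj₁ (y , _)) = x G.≈ y
  ExpansionAdj (inj₂ (x , _)) (inj₂ (y , _)) = G₂.InE x y

  private
    adj-sym : Symmetric ExpansionAdj
    adj-sym {inj₁ _} {inj₁ _} = G₁.InE-sym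
    adj-sym {inj₁ _} {inj₂ _} = G.sym
    adj-sym {inj₂ _} {inj₁ _} = G.sym
    adj-sym {inj₂ _} {inj₂ _} = G₂.InE-sym

    adj-respʳ : ∀ {u v w} →
      Setoid._≈_ (vertices G₁.graph ⊎ₛ vertices G₂.graph) v w →
      ExpansionAdj u v → ExpansionAdj u w
    adj-respʳ {inj₁ _} (inj₁ e) = proj₁ G₁.InE-resp e
    adj-respʳ {inj₁ _} (inj₂ e) = λ d → G.trans d e
    adj-respʳ {inj₂ _} (inj₁ e) = λ d → G.trans d e
    adj-respʳ {inj₂ _} (inj₂ e) = proj₁ G₂.InE-resp e

  expansion : Graph ℓ
  expansion = record
    { vertices = vertices G₁.graph ⊎ₛ vertices G₂.graph
    ; nonempty = inj₁ G₁.nonempty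
    ; _~_      = ExpansionAdj
    ; ~-resp   =
        (λ {u} → adj-respʳ {u})
      , (λ {u} {v} {w} e d →
          adj-sym {u} {w} (adj-respʳ {u} e (adj-sym {v} {u} d)))
    ; ~-sym    = λ {u} {v} → adj-sym {u} {v}
    ; ~-irrefl = λ { (inj₁ e) d → G.~-irrefl e (G₁.InE⇒~ d)
                   ; (inj₂ e) d → G.~-irrefl e (G₂.InE⇒~ d) }
    }

infix 4 _≅_ _IsExpansionOf_ _IsContractionOf_

_≅_ : Graph ℓ → Graph ℓ → Set ℓ
G ≅ H =
  Σ[ i ∈ Inverse (vertices G) (vertices H) ]
  (∀ x y → Graph._~_ G x y ⇔ Graph._~_ H (Inverse.to i x) (Inverse.to i y))

_IsExpansionOf_ : Graph ℓ → Graph ℓ → Set (suc ℓ)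
G′ IsExpansionOf G =
    Connected G
  × Σ[ G₁ ∈ Subgraph G ] Σ[ G₂ ∈ Subgraph G ]
      ( Subgraph.Isometric G₁
      × Subgraph.Isometric G₂
      × IsUnion G G₁ G₂
      × G′ ≅ expansion G G₁ G₂ )

_IsContractionOf_ : Graph ℓ → Graph ℓ → Set (suc ℓ)
G IsContractionOf G′ = G′ IsExpansionOf G

{-# OPTIONS --safe #-}
-- The distance between two vertices of a hypercube is the size of their
-- symmetric difference, and in the expansion, writing x^i for the copy of x in
-- V′_i, d′(x^i , y^j) = d(x , y) + [i ≠ j]: a geodesic from V₁ to V₂ crosses
-- V₁ ∩ V₂, where its lift changes copies.
-- (i) If f embeds G, then x^i ↦ f x, together with one new element when i = 2,
-- embeds G′.
-- (ii) If F embeds G′, fix z in V₁ ∩ V₂; then x ↦ F x^i Δ F z^i embeds G.  It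
-- does not depend on the choice of i because F x¹ Δ F x² is the same singleton
-- for every x in V₁ ∩ V₂.
module Submission where

open import Level using (Level; Lift)
open import Data.Bool using (Bool; true; false; T; _xor_)
open import Data.Bool.Properties using (T?; xor-comm; xor-same)
open import Data.Bool.Solver using (module xor-∧-Solver)
open import Data.Empty using (⊥-elim)
open import Data.Fin using (Fin; zero; suc; punchIn; punchOut)
open import Data.Fin.Properties
  using (punchIn-injective; punchInᵢ≢i; punchIn-punchOut; injective⇒≤)
open import Data.Nat using (ℕ; zero; suc; _+_; _≤_; _<_; z≤n; s≤s; _≤?_)
open import Data.Nat.Induction using (<-rec)
open import Data.Nat.Properties
  using ( ≤-refl; ≤-reflexive; ≤-trans; ≤-antisym; <-irrefl; ≮⇒≥; n≤1+n
        ; +-suc; +-comm; +-identityʳ; +-monoˡ-≤; +-monoʳ-≤; +-mono-≤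
        ; +-cancelˡ-≤; +-commutativeSemigroup; module ≤-Reasoning)
open import Algebra.Properties.CommutativeSemigroup +-commutativeSemigroup
  using (interchange)
open import Data.Product using (Σ-syntax; ∃; _×_; _,_; proj₁; proj₂)
open import Data.Sum using (_⊎_; inj₁; inj₂)
open import Data.Sum.Relation.Binary.Pointwise using (_⊎ₛ_; inj₁; inj₂)
open import Data.Unit using (⊤)
open import Function.Base using (_∘_)
open import Function.Bundles using (Func; Inverse; _⟨$⟩_; mk⇔; Equivalence)
import Function.Construct.Composition as Composition
import Function.Construct.Symmetry as Symmetry
open import Function.Properties.Inverse using (toFunction; fromFunction)
open import Relation.Binary.Bundles using (Setoid)
open import Relation.Binary.PropositionalEquality as ≡
  using (_≡_; _≢_; refl; cong; subst)
open import Relation.Nullary using (¬_; yes; no)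
open import Relation.Nullary.Decidable using (decidable-stable)
open import Defs

private
  variable
    ℓ : Level

-- Boolean identities behind symmetric differences

T-xor : ∀ a b → T (a xor b) → (T a × ¬ T b) ⊎ (¬ T a × T b)
T-xor true  false _ = inj₁ (_ , λ ())
T-xor false true  _ = inj₂ ((λ ()) , _)

xor-introˡ : ∀ {a b} → T a → ¬ T b → T (a xor b)
xor-introˡ {true} {false} _ _  = _
xor-introˡ {true} {true}  _ ¬b = ⊥-elim (¬b _)

xor-introʳ : ∀ {a b} → ¬ T a → T b → T (a xor b)
xor-introʳ {false} _  b = b
xor-introʳ {true}  ¬a _ = ⊥-elim (¬a _)

T-⇔⇒≡ : ∀ {a b} → (T a → T b) → (T b → T a) → a ≡ b
T-⇔⇒≡ {true}  {true}  _ _ = refl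
T-⇔⇒≡ {true}  {false} f _ = ⊥-elim (f _)
T-⇔⇒≡ {false} {true}  _ g = ⊥-elim (g _)
T-⇔⇒≡ {false} {false} _ _ = refl

-- Around a closed 4-cycle the number of changes of value is even. It moves an element from one
-- crossing edge to a parallel one.
xor-square : ∀ a b c d → T (a xor b) → ¬ T (a xor c) → ¬ T (b xor d) → T (c xor d)
xor-square true  false true  false _ _   _   = _
xor-square false true  false true  _ _   _   = _
xor-square true  false false _     _ ¬ac _   = ⊥-elim (¬ac _)
xor-square true  false true  true  _ _   ¬bd = ⊥-elim (¬bd _)
xor-square false true  true  _     _ ¬ac _   = ⊥-elim (¬ac _)
xor-square false true  false false _ _   ¬bd = ⊥-elim (¬bd _)

xor-exchange : ∀ a b c d → a xor b ≡ c xor d → a xor c ≡ b xor d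
xor-exchange a b c d eq = begin
  a xor c                 ≡⟨ solve 3 (λ a b c → a :+ c := (a :+ b) :+ (b :+ c)) refl a b c ⟩
  (a xor b) xor (b xor c) ≡⟨ cong (_xor (b xor c)) eq ⟩
  (c xor d) xor (b xor c) ≡⟨ solve 3 (λ b c d → (c :+ d) :+ (b :+ c) := b :+ d) refl b c d ⟩
  b xor d                 ∎
  where
  open ≡.≡-Reasoning
  open xor-∧-Solver

-- Cardinality of subsets

module _ {X : Setoid ℓ ℓ} where
  private
    module X = Setoid X

    variable
      m n k : ℕ
      P Q R S S′ : Subset X

  open X using (Carrier; _≈_)

  infix 4 _∈_

  _∈_ : Carrier → Subset X → Set
  x ∈ P = T (P ⟨$⟩ x)

  ∈-resp : ∀ (P : Subset X) {x y} → x ≈ y → x ∈ P → y ∈ P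
  ∈-resp P x≈y = subst T (Func.cong P x≈y)

  -- `HasSize` with the bijection unpacked. That `index` respects `_≈_` and ignores the membership
  -- proof need not be a field, as it follows from `injective` and `element-index`.
  record Enumeration (P : Subset X) (n : ℕ) : Set ℓ where
    field
      element       : Fin n → Carrier
      element∈      : ∀ i → element i ∈ P
      injective     : ∀ {i j} → element i ≈ element j → i ≡ j
      index         : ∀ {x} → x ∈ P → Fin n
      element-index : ∀ {x} (x∈P : x ∈ P) → element (index x∈P) ≈ x

  open Enumeration

  HasSize⇒Enumeration : ∀ P → HasSize P n → Enumeration P n
  HasSize⇒Enumeration _ s = record
    { element       = λ i → proj₁ (to i)
    ; element∈      = λ i → proj₂ (to i)
    ; injective     = λ {i} e →
        ≡.trans (≡.sym (strictlyInverseʳ i)) (inverseʳ {y = to i} e)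
    ; index         = λ {x} x∈P → from (x , x∈P)
    ; element-index = λ _ → inverseˡ refl
    }
    where open Inverse s

  Enumeration⇒HasSize : Enumeration P n → HasSize P n
  Enumeration⇒HasSize {P = P} e = record
    { to        = λ i → element e i , element∈ e i
    ; from      = λ (_ , x∈P) → index e x∈P
    ; to-cong   = λ { refl → X.refl }
    ; from-cong = λ {(_ , x∈P)} {(_ , y∈P)} x≈y → injective e
        (X.trans (element-index e x∈P) (X.trans x≈y (X.sym (element-index e y∈P))))
    ; inverse   = (λ { {_ , x∈P} refl → element-index e x∈P })
                , λ { {_} {_ , y∈P} y≈x → injective e (X.trans (element-index e y∈P) y≈x) }
    }

  enumerate : ((P , n , _) : FiniteSubset X) → Enumeration P n
  enumerate (P , _ , p) = HasSize⇒Enumeration P p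

  Enumeration-resp : P ≐ Q → Enumeration P n → Enumeration Q n
  Enumeration-resp P≐Q e = record
    { element       = element e
    ; element∈      = λ i → subst T (P≐Q _) (element∈ e i)
    ; injective     = injective e
    ; index         = λ x∈Q → index e (subst T (≡.sym (P≐Q _)) x∈Q)
    ; element-index = λ _ → element-index e _
    }

  size-mono : (∀ {x} → x ∈ P → x ∈ Q) → Enumeration P m → Enumeration Q n → m ≤ n
  size-mono P⊆Q p q = injective⇒≤ λ {i} {j} same → injective p
    (X.trans (X.sym (element-index q (P⊆Q (element∈ p i))))
      (X.trans (X.reflexive (cong (element q) same))
        (element-index q (P⊆Q (element∈ p j)))))

  size-unique : Enumeration P m → Enumeration P n → m ≡ n
  size-unique p q = ≤-antisym (size-mono (λ x∈P → x∈P) p q) (size-mono (λ x∈P → x∈P) q p)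

  Enumeration-∅ : (∀ x → ¬ x ∈ P) → Enumeration P 0
  Enumeration-∅ empty = record
    { element       = λ ()
    ; element∈      = λ ()
    ; injective     = λ { {()} }
    ; index         = λ x∈P → ⊥-elim (empty _ x∈P)
    ; element-index = λ x∈P → ⊥-elim (empty _ x∈P)
    }

  Δ-self : P ≐ Q → Enumeration (P Δ Q) 0
  Δ-self {P} {Q} P≐Q = Enumeration-∅ λ x x∈ →
    subst T (≡.trans (cong (_xor (Q ⟨$⟩ x)) (P≐Q x)) (xor-same (Q ⟨$⟩ x))) x∈

  size-0⇒≐ : Enumeration (P Δ Q) 0 → P ≐ Q
  size-0⇒≐ {P} {Q} e x with P ⟨$⟩ x in p | Q ⟨$⟩ x in q
  ... | true  | true  = refl
  ... | false | false = refl
  ... | true  | false with () ← index e {x} (subst T (≡.sym (≡.cong₂ _xor_ p q)) _)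
  ... | false | true  with () ← index e {x} (subst T (≡.sym (≡.cong₂ _xor_ p q)) _)

  the : Enumeration S 1 → Carrier
  the s = element s zero

  the∈ : (s : Enumeration S 1) → the s ∈ S
  the∈ s = element∈ s zero

  the-unique : (s : Enumeration S 1) → ∀ {x} → x ∈ S → the s ≈ x
  the-unique s x∈S with index s x∈S | element-index s x∈S
  ... | zero | a≈x = a≈x

  singleton-≐ : (s : Enumeration S 1) → Enumeration S′ 1 → the s ∈ S′ → S ≐ S′
  singleton-≐ {S} {S′} s s′ a∈S′ x = T-⇔⇒≡
    (λ x∈S → ∈-resp S′ (the-unique s x∈S) a∈S′)
    (λ x∈S′ → ∈-resp S (X.trans (X.sym (the-unique s′ a∈S′)) (the-unique s′ x∈S′)) (the∈ s))

  -- All elements of `S` are equal to `the s`, so `S` is disjoint from `P` or contained in it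
  -- according to whether `the s` lies in `P`. Here it is disjoint; `remove` treats the other case.
  insert : Enumeration P n → (s : Enumeration S 1) → ¬ the s ∈ P → Enumeration (P Δ S) (suc n)
  insert {P} {n} {S} p s a∉P = record
    { element       = el
    ; element∈      = el∈
    ; injective     = λ {i} {j} → el-inj i j
    ; index         = λ x∈ → proj₁ (find x∈)
    ; element-index = λ x∈ → proj₂ (find x∈)
    }
    where
    el : Fin (suc n) → Carrier
    el zero    = the s
    el (suc i) = element p i

    el∈ : ∀ i → el i ∈ (P Δ S)
    el∈ zero    = xor-introʳ a∉P (the∈ s)
    el∈ (suc i) = xor-introˡ (element∈ p i)
      λ i∈S → a∉P (∈-resp P (X.sym (the-unique s i∈S)) (element∈ p i))

    el-inj : ∀ i j → el i ≈ el j → i ≡ j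
    el-inj zero    zero    _ = refl
    el-inj zero    (suc j) e = ⊥-elim (a∉P (∈-resp P (X.sym e) (element∈ p j)))
    el-inj (suc i) zero    e = ⊥-elim (a∉P (∈-resp P e (element∈ p i)))
    el-inj (suc i) (suc j) e = cong suc (injective p e)

    find : ∀ {x} → x ∈ (P Δ S) → ∃ λ i → el i ≈ x
    find {x} x∈ with T-xor (P ⟨$⟩ x) (S ⟨$⟩ x) x∈
    ... | inj₁ (x∈P , _) = suc (index p x∈P) , element-index p x∈P
    ... | inj₂ (_ , x∈S) = zero , the-unique s x∈S

  remove : Enumeration P (suc n) → (s : Enumeration S 1) → the s ∈ P → Enumeration (P Δ S) n
  remove {P} {n} {S} p s a∈P = record
    { element       = λ i → element p (punchIn a i)
    ; element∈      = λ i → xor-introˡ (element∈ p _) λ i∈S → punchInᵢ≢i a i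
        (injective p (X.trans (X.sym (the-unique s i∈S)) (X.sym (element-index p a∈P))))
    ; injective     = λ e → punchIn-injective a _ _ (injective p e)
    ; index         = λ x∈ → proj₁ (find x∈)
    ; element-index = λ x∈ → proj₂ (find x∈)
    }
    where
    a : Fin (suc n)
    a = index p a∈P

    find : ∀ {x} → x ∈ (P Δ S) → ∃ λ i → element p (punchIn a i) ≈ x
    find {x} x∈ with T-xor (P ⟨$⟩ x) (S ⟨$⟩ x) x∈
    ... | inj₂ (x∉P , x∈S) = ⊥-elim (x∉P (∈-resp P (the-unique s x∈S) a∈P))
    ... | inj₁ (x∈P , x∉S) = punchOut a≢x ,
      X.trans (X.reflexive (cong (element p) (punchIn-punchOut a≢x))) (element-index p x∈P)
      where
      a≢x : a ≢ index p x∈P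
      a≢x eq = x∉S (∈-resp S
        (X.trans (X.sym (element-index p a∈P))
          (X.trans (X.reflexive (cong (element p) eq)) (element-index p x∈P)))
        (the∈ s))

  -- Membership in a subset is Boolean, so whether to insert or to remove is decidable. The upper
  -- bound on the size is all that the triangle inequality needs.
  toggle : Enumeration P n → Enumeration S 1 → ∃ λ k → k ≤ suc n × Enumeration (P Δ S) k
  toggle {P} {n} p s with T? (P ⟨$⟩ the s)
  ... | no a∉P = suc n , ≤-refl , insert p s a∉P
  toggle {n = zero}  p s | yes a∈P with () ← index p a∈P
  toggle {n = suc n} p s | yes a∈P = n , ≤-trans (n≤1+n n) (n≤1+n (suc n)) , remove p s a∈P

  -- Otherwise `S` is contained in `P`, hence so is `P Δ S`, which then cannot be larger than `P`.
  toggle-grows⇒∉ : Enumeration P n → (s : Enumeration S 1) → Enumeration (P Δ S) (suc n) →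
    ¬ the s ∈ P
  toggle-grows⇒∉ {P} {n} {S} p s ps a∈P = <-irrefl refl (size-mono shrinks ps p)
    where
    shrinks : ∀ {x} → x ∈ (P Δ S) → x ∈ P
    shrinks {x} x∈ with T-xor (P ⟨$⟩ x) (S ⟨$⟩ x) x∈
    ... | inj₁ (x∈P , _) = x∈P
    ... | inj₂ (_ , x∈S) = ∈-resp P (the-unique s x∈S) a∈P

  -- Finite sets have decidable equality on their elements, so a single element
  -- can be cut out of P although equality on X is undecidable.
  split : Enumeration P (suc n) → ∃ λ S → Enumeration S 1 × Enumeration (P Δ S) n
  split {P} {n} p = A , s , remove p s (element∈ p zero)
    where
    isZero : Fin (suc n) → Bool
    isZero zero    = true
    isZero (suc _) = false

    -- The subset cut out consists of the points of `P` with index zero. The index needs a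
    -- membership proof, so `χ` takes the Boolean `b` apart from it: matching on `b` supplies the
    -- proof.
    χ : ∀ b → (T b → Fin (suc n)) → Bool
    χ true  i = isZero (i _)
    χ false _ = false

    χ-cong : ∀ {b c} i j → b ≡ c → (∀ p q → i p ≡ j q) → χ b i ≡ χ c j
    χ-cong {true}  i j refl eq = cong isZero (eq _ _)
    χ-cong {false} i j refl eq = refl

    χ-elim : ∀ b i → T (χ b i) → Σ[ t ∈ T b ] i t ≡ zero
    χ-elim true i t with i _ in eq
    ... | zero = _ , eq

    χ-intro : ∀ {b} i (t : T b) → i t ≡ zero → T (χ b i)
    χ-intro {true} i t eq = subst (T ∘ isZero) (≡.sym eq) _

    A : Subset X
    A = record
      { to   = λ x → χ (P ⟨$⟩ x) (index p)
      ; cong = λ x≈y → χ-cong (index p) (index p) (Func.cong P x≈y) λ x∈P y∈P → injective p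
          (X.trans (element-index p x∈P) (X.trans x≈y (X.sym (element-index p y∈P))))
      }

    s : Enumeration A 1
    s = record
      { element       = λ _ → element p zero
      ; element∈      = λ _ → χ-intro (index p) (element∈ p zero)
          (injective p (element-index p (element∈ p zero)))
      ; injective     = λ { {zero} {zero} _ → refl }
      ; index         = λ _ → zero
      ; element-index = λ {x} x∈A → let (x∈P , eq) = χ-elim (P ⟨$⟩ x) (index p) x∈A in
          X.trans (X.reflexive (cong (element p) (≡.sym eq))) (element-index p x∈P)
      }

  -- Induction on the size of `Q`: moving one element `S` of `Q` across uses
  -- `(P Δ S) Δ (Q Δ S) = P Δ Q`, and each toggle adds at most one element. This also yields
  -- finiteness of `P Δ Q` without deciding equality on `X`.
  Δ-size : Enumeration P m → Enumeration Q n → ∃ λ k → k ≤ m + n × Enumeration (P Δ Q) k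
  Δ-size {P} {m} {Q} {zero} p q =
    m , ≤-reflexive (≡.sym (+-identityʳ m)) , Enumeration-resp P≐PΔQ p
    where
    P≐PΔQ : P ≐ (P Δ Q)
    P≐PΔQ x with Q ⟨$⟩ x in eq
    ... | false = xor-comm false (P ⟨$⟩ x)
    ... | true with () ← index q {x} (subst T (≡.sym eq) _)
  Δ-size {P} {m} {Q} {suc n} p q =
    let (S , s , q′)   = split q
        (j , j≤ , ps)  = toggle p s
        (k , k≤ , psq) = Δ-size ps q′
    in k
     , ≤-trans k≤ (≤-trans (+-monoˡ-≤ n j≤) (≤-reflexive (≡.sym (+-suc m n))))
     , Enumeration-resp (λ x → solve 3 (λ p q s → (p :+ s) :+ (q :+ s) := p :+ q) refl
         (P ⟨$⟩ x) (Q ⟨$⟩ x) (S ⟨$⟩ x)) psq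
    where open xor-∧-Solver

  Δ-triangle : Enumeration (P Δ Q) m → Enumeration (Q Δ R) n → Enumeration (P Δ R) k → k ≤ m + n
  Δ-triangle {P} {Q} {R = R} pq qr pr =
    let (_ , k≤ , pr′) = Δ-size pq qr
    in subst (_≤ _) (size-unique (Enumeration-resp (λ x →
         solve 3 (λ p q r → (p :+ q) :+ (q :+ r) := p :+ r) refl
           (P ⟨$⟩ x) (Q ⟨$⟩ x) (R ⟨$⟩ x)) pr′) pr) k≤
    where open xor-∧-Solver

-- Walks and distances

module _ (G : Graph ℓ) where
  open Graph G

  walk-respˡ : ∀ {n x y z} → x ≈ y → Walk G n x z → Walk G n y z
  walk-respˡ x≈y (stop x≈z)   = stop (trans (sym x≈y) x≈z)
  walk-respˡ x≈y (step x~w w) = step (proj₂ ~-resp x≈y x~w) w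

  walk-respʳ : ∀ {n x y z} → y ≈ z → Walk G n x y → Walk G n x z
  walk-respʳ y≈z (stop x≈y)   = stop (trans x≈y y≈z)
  walk-respʳ y≈z (step x~w w) = step x~w (walk-respʳ y≈z w)

  infixr 5 _++_

  _++_ : ∀ {m n x y z} → Walk G m x y → Walk G n y z → Walk G (m + n) x z
  stop x≈y   ++ w = walk-respˡ (sym x≈y) w
  step x~u v ++ w = step x~u (v ++ w)

  reverse : ∀ {n x y} → Walk G n x y → Walk G n y x
  reverse (stop x≈y) = stop (sym x≈y)
  reverse {suc n} {x} {y} (step x~u w) =
    subst (λ k → Walk G k y x) (+-comm n 1)
      (reverse w ++ step (~-sym x~u) (stop (Setoid.refl vertices)))

  distance-resp : ∀ {n x x′ y y′} → x ≈ x′ → y ≈ y′ → IsDistance G x y n → IsDistance G x′ y′ n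
  distance-resp x≈x′ y≈y′ (w , least) =
      walk-respˡ x≈x′ (walk-respʳ y≈y′ w)
    , λ m v → least m (walk-respˡ (sym x≈x′) (walk-respʳ (sym y≈y′) v))

  distance-sym : ∀ {n x y} → IsDistance G x y n → IsDistance G y x n
  distance-sym (w , least) = reverse w , λ m v → least m (reverse v)

  distance-unique : ∀ {m n x y} → IsDistance G x y m → IsDistance G x y n → m ≡ n
  distance-unique (v , v-least) (w , w-least) = ≤-antisym (v-least _ w) (w-least _ v)

  distance-refl : ∀ {x y} → x ≈ y → IsDistance G x y 0
  distance-refl x≈y = stop x≈y , λ _ _ → z≤n

  distance-edge : ∀ {x y} → x ~ y → IsDistance G x y 1
  distance-edge x~y = step x~y (stop (Setoid.refl vertices)) , λ
    { 0       (stop x≈y) → ⊥-elim (~-irrefl x≈y x~y)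
    ; (suc _) _          → s≤s z≤n
    }

  -- The minimum of a nonempty set of naturals exists only up to ¬¬.
  ¬¬distance : ∀ {n x y} → Walk G n x y → ¬ ¬ ∃ (IsDistance G x y)
  ¬¬distance {n} {x} {y} w none = <-rec (λ n → ¬ Walk G n x y) shorter n w
    where
    -- A walk of length `n` with no shorter walk beside it is a shortest one, which `none` excludes.
    shorter : ∀ n → (∀ {m} → m < n → ¬ Walk G m x y) → ¬ Walk G n x y
    shorter n none< w = none (n , w , λ m v → ≮⇒≥ λ m<n → none< m<n v)

-- Maps between graphs and isomorphisms

module _ {G H : Graph ℓ} where
  private
    module G = Graph G
    module H = Graph H

  walk-map : (f : Func G.vertices H.vertices) →
             (∀ {x y} → x G.~ y → (f ⟨$⟩ x) H.~ (f ⟨$⟩ y)) →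
             ∀ {n x y} → Walk G n x y → Walk H n (f ⟨$⟩ x) (f ⟨$⟩ y)
  walk-map f hom (stop x≈y)   = stop (Func.cong f x≈y)
  walk-map f hom (step x~u w) = step (hom x~u) (walk-map f hom w)

  -- Distances are unique, so one common value for each pair settles the equivalence for every `n`.
  common-distance⇒isometric : (f : Func G.vertices H.vertices) →
    (∀ x y → ∃ λ n → IsDistance G x y n × IsDistance H (f ⟨$⟩ x) (f ⟨$⟩ y) n) →
    IsIsometric G H f
  common-distance⇒isometric f common x y n =
    let (k , g , h) = common x y in mk⇔
      (λ g′ → subst (IsDistance H _ _) (distance-unique G g g′) h)
      (λ h′ → subst (IsDistance G _ _) (distance-unique H h h′) g)

≅-sym : {G H : Graph ℓ} → G ≅ H → H ≅ G
≅-sym {G = G} {H} (i , adj) = Symmetry.inverse i , λ x y → mk⇔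
  (λ x~y → Equivalence.from (adj _ _)
    (H-resp (H.sym (strictlyInverseˡ x)) (H.sym (strictlyInverseˡ y)) x~y))
  (λ x~y → H-resp (strictlyInverseˡ x) (strictlyInverseˡ y) (Equivalence.to (adj _ _) x~y))
  where
  open Inverse i
  module H = Graph H
  H-resp : ∀ {x x′ y y′} → x H.≈ x′ → y H.≈ y′ → x H.~ y → x′ H.~ y′
  H-resp p q = proj₂ H.~-resp p ∘ proj₁ H.~-resp q

≅⇒isometric : {G H : Graph ℓ} ((i , _) : G ≅ H) → IsIsometric G H (toFunction i)
≅⇒isometric {G = G} {H} iso@(i , adj) x y n = mk⇔
  (λ (w , least) → there w , λ m v → least m (back v))
  (λ (w , least) → back w , λ m v → least m (there v))
  where
  open Inverse i
  there : ∀ {m} → Walk G m x y → Walk H m (to x) (to y)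
  there = walk-map (toFunction i) (Equivalence.to (adj _ _))
  back : ∀ {m} → Walk H m (to x) (to y) → Walk G m x y
  back w = walk-respˡ G (strictlyInverseʳ x) (walk-respʳ G (strictlyInverseʳ y)
    (walk-map (fromFunction i) (Equivalence.to (proj₂ (≅-sym {G = G} {H} iso) _ _)) w))

IsPartialCube-resp-≅ : {G H : Graph ℓ} → G ≅ H → IsPartialCube H → IsPartialCube G
IsPartialCube-resp-≅ {G = G} {H} iso (X , f , f-iso) =
  X , Composition.function (toFunction (proj₁ iso)) f ,
  λ x y n → Composition.equivalence (≅⇒isometric {G = G} {H} iso x y n) (f-iso _ _ n)

-- Distances in hypercubes

module _ {X : Setoid ℓ ℓ} where
  private
    H = Hypercube X

  -- Toggling in `P` the elements of `P Δ Q` one at a time reaches `Q`. Each toggle is an edge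
  -- because `P Δ (P Δ S) = S`.
  size⇒walk : ∀ n (P Q : FiniteSubset X) → Enumeration (proj₁ P Δ proj₁ Q) n → Walk H n P Q
  size⇒walk zero    _       _       pq = stop (size-0⇒≐ pq)
  size⇒walk (suc n) P′@(P , _) (Q , _) pq =
    let (S , s , rest) = split pq
        (_ , _ , ps)   = toggle (enumerate P′) s
    in step {y = P Δ S , _ , Enumeration⇒HasSize ps}
         (Enumeration⇒HasSize {P = P Δ (P Δ S)} (Enumeration-resp
           (λ x → solve 2 (λ p s → s := p :+ (p :+ s)) refl (P ⟨$⟩ x) (S ⟨$⟩ x)) s))
         (size⇒walk n _ _ (Enumeration-resp
           (λ x → solve 3 (λ p q s → (p :+ q) :+ s := (p :+ s) :+ q) refl
             (P ⟨$⟩ x) (Q ⟨$⟩ x) (S ⟨$⟩ x)) rest))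
    where open xor-∧-Solver

  Δ-finite : (P Q : FiniteSubset X) → ∃ λ n → Enumeration (proj₁ P Δ proj₁ Q) n
  Δ-finite P Q = let (n , _ , pq) = Δ-size (enumerate P) (enumerate Q) in n , pq

  -- Every edge contributes a difference of size one, and sizes of differences satisfy the triangle
  -- inequality.
  walk⇒size≤ : ∀ {m n} (P Q : FiniteSubset X) →
    Walk H m P Q → Enumeration (proj₁ P Δ proj₁ Q) n → n ≤ m
  walk⇒size≤ P Q (stop P≐Q) pq = ≤-reflexive (size-unique pq (Δ-self P≐Q))
  walk⇒size≤ {suc m} P Q (step {y = R} P~R w) pq =
    let (_ , rq) = Δ-finite R Q
    in ≤-trans (Δ-triangle (HasSize⇒Enumeration (proj₁ P Δ proj₁ R) P~R) rq pq) (s≤s (walk⇒size≤ R Q w rq))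

  size⇒distance : ∀ {n} (P Q : FiniteSubset X) →
    Enumeration (proj₁ P Δ proj₁ Q) n → IsDistance H P Q n
  size⇒distance P Q pq = size⇒walk _ P Q pq , λ m w → walk⇒size≤ P Q w pq

  distance⇒size : ∀ {n} (P Q : FiniteSubset X) →
    IsDistance H P Q n → Enumeration (proj₁ P Δ proj₁ Q) n
  distance⇒size P Q d =
    let (_ , pq) = Δ-finite P Q
    in subst (Enumeration _) (distance-unique H {x = P} {Q} (size⇒distance P Q pq) d) pq

-- Adjoining one element to the ground set

bit : Bool → ℕ
bit false = 0
bit true  = 1

bit-xor-triangle : ∀ a b c → bit (a xor c) ≤ bit (a xor b) + bit (b xor c)
bit-xor-triangle false false c     = ≤-refl
bit-xor-triangle true  true  c     = ≤-refl
bit-xor-triangle false true  false = z≤n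
bit-xor-triangle false true  true  = ≤-refl
bit-xor-triangle true  false false = ≤-refl
bit-xor-triangle true  false true  = z≤n

module _ {X : Setoid ℓ ℓ} where
  private
    module X = Setoid X

  X+1 : Setoid ℓ ℓ
  X+1 = X ⊎ₛ ≡.setoid (Lift ℓ ⊤)

  extend : Subset X → Bool → Subset X+1
  extend P b = record
    { to   = λ { (inj₁ x) → P ⟨$⟩ x ; (inj₂ _) → b }
    ; cong = λ { (inj₁ x≈y) → Func.cong P x≈y ; (inj₂ _) → refl }
    }

  extend-size : ∀ {P n} b → Enumeration P n → Enumeration (extend P b) (bit b + n)
  extend-size {P} false p = record
    { element       = inj₁ ∘ element
    ; element∈      = element∈
    ; injective     = λ { (inj₁ e) → injective e }
    ; index         = λ { {inj₁ x} x∈P → index x∈P }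
    ; element-index = λ { {inj₁ x} x∈P → inj₁ (element-index x∈P) }
    }
    where open Enumeration p
  extend-size {P} {n} true p = record
    { element       = el
    ; element∈      = λ { zero → _ ; (suc i) → element∈ i }
    ; injective     = λ {i} {j} → el-inj i j
    ; index         = λ { {inj₁ x} x∈P → suc (index x∈P) ; {inj₂ _} _ → zero }
    ; element-index = λ { {inj₁ x} x∈P → inj₁ (element-index x∈P) ; {inj₂ _} _ → inj₂ refl }
    }
    where
    open Enumeration p
    el : Fin (suc n) → Setoid.Carrier X+1
    el zero    = inj₂ _
    el (suc i) = inj₁ (element i)
    el-inj : ∀ i j → Setoid._≈_ X+1 (el i) (el j) → i ≡ j
    el-inj zero    zero    _        = refl
    el-inj (suc i) (suc j) (inj₁ e) = cong suc (injective e)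

  extend-Δ : ∀ P Q b c → extend (P Δ Q) (b xor c) ≐ (extend P b Δ extend Q c)
  extend-Δ P Q b c (inj₁ _) = refl
  extend-Δ P Q b c (inj₂ _) = refl

-- Distances in an expansion

module Expansion {G : Graph ℓ} (G₁ G₂ : Subgraph G)
  (G₁-isometric : Subgraph.Isometric G₁) (G₂-isometric : Subgraph.Isometric G₂)
  (G=G₁∪G₂ : IsUnion G G₁ G₂) where

  open Graph G renaming (refl to ≈-refl; sym to ≈-sym)
  private
    module G₁ = Subgraph G₁
    module G₂ = Subgraph G₂

  E : Graph ℓ
  E = expansion G G₁ G₂

  W : Set ℓ
  W = Graph.V E

  π : W → V
  π (inj₁ (x , _)) = x
  π (inj₂ (x , _)) = x

  side : W → Bool
  side (inj₁ _) = false
  side (inj₂ _) = true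

  -- The term [i ≠ j] of the distance formula.
  cross : W → W → ℕ
  cross u v = bit (side u xor side v)

  inj₁ᶠ : Func (Graph.vertices G₁.graph) (Graph.vertices E)
  inj₁ᶠ = record { to = inj₁ ; cong = inj₁ }

  inj₂ᶠ : Func (Graph.vertices G₂.graph) (Graph.vertices E)
  inj₂ᶠ = record { to = inj₂ ; cong = inj₂ }

  -- An edge of the expansion either changes copies or moves along an edge of `G`, never both.
  project-edge : ∀ u v → Graph._~_ E u v → ∃ λ m → Walk G m (π u) (π v) × cross u v + m ≤ 1
  project-edge (inj₁ _) (inj₁ _) e   = 1 , step (G₁.InE⇒~ e) (stop ≈-refl) , ≤-refl
  project-edge (inj₁ _) (inj₂ _) x≈y = 0 , stop x≈y , ≤-refl
  project-edge (inj₂ _) (inj₁ _) x≈y = 0 , stop x≈y , ≤-refl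
  project-edge (inj₂ _) (inj₂ _) e   = 1 , step (G₂.InE⇒~ e) (stop ≈-refl) , ≤-refl

  project : ∀ {n} u v → Walk E n u v → ∃ λ m → Walk G m (π u) (π v) × cross u v + m ≤ n
  project _ _ (stop (inj₁ x≈y)) = 0 , stop x≈y , z≤n
  project _ _ (stop (inj₂ x≈y)) = 0 , stop x≈y , z≤n
  project {suc n} u v (step {y = t} u~t w) =
    let (i , p , i≤) = project-edge u t u~t
        (j , q , j≤) = project t v w
    in i + j , _++_ G p q , (begin
      cross u v + (i + j)
        ≤⟨ +-monoˡ-≤ (i + j) (bit-xor-triangle (side u) (side t) (side v)) ⟩
      cross u t + cross t v + (i + j)   ≡⟨ interchange (cross u t) (cross t v) i j ⟩
      (cross u t + i) + (cross t v + j) ≤⟨ +-mono-≤ i≤ j≤ ⟩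
      suc n                             ∎)
    where open ≤-Reasoning

  -- Follow the walk while its edges are taken from `G₁`. It first stops at the source of an edge of
  -- `G₂` or at its end, and either vertex lies in both subgraphs.
  crossing : ∀ {n x y} → Walk G n x y → (x∈₁ : G₁.InV x) → G₂.InV y →
    Σ[ z ∈ V ] Σ[ a ∈ ℕ ] Σ[ b ∈ ℕ ] Σ[ z∈₁ ∈ G₁.InV z ]
      G₂.InV z × Walk G₁.graph a (x , x∈₁) (z , z∈₁) × Walk G b z y × a + b ≡ n
  crossing (stop x≈y) x∈₁ y∈₂ =
    _ , 0 , 0 , x∈₁ , G₂.InV-resp (≈-sym x≈y) y∈₂ , stop ≈-refl , stop x≈y , refl
  crossing (step x~u w) x∈₁ y∈₂ with proj₂ G=G₁∪G₂ _ _ x~u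
  ... | inj₂ e = _ , 0 , _ , x∈₁ , G₂.source e , stop ≈-refl , step x~u w , refl
  ... | inj₁ e =
    let (z , a , b , z∈₁ , z∈₂ , v , w , a+b≡n) = crossing w (G₁.target e) y∈₂
    in z , suc a , b , z∈₁ , z∈₂ , step e v , w , cong suc a+b≡n

  lift₁ : ∀ {n} {x y : G₁.graph .Graph.V} → Walk G₁.graph n x y → Walk E n (inj₁ x) (inj₁ y)
  lift₁ = walk-map {G = G₁.graph} {E} inj₁ᶠ (λ e → e)

  lift₂ : ∀ {n} {x y : G₂.graph .Graph.V} → Walk G₂.graph n x y → Walk E n (inj₂ x) (inj₂ y)
  lift₂ = walk-map {G = G₂.graph} {E} inj₂ᶠ (λ e → e)

  -- The part of a geodesic behind the crossing is a geodesic, so it may be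
  -- replaced by one inside G₂.
  lift₁₂ : ∀ {d} (x : Graph.V G₁.graph) (y : Graph.V G₂.graph) →
    IsDistance G (proj₁ x) (proj₁ y) d → Walk E (suc d) (inj₁ x) (inj₂ y)
  lift₁₂ {d} x y (w , least) with crossing w (proj₂ x) (proj₂ y)
  ... | z , a , b , z∈₁ , z∈₂ , xz , zy , refl =
    -- The additional step is the edge joining the two copies of `z`.
    subst (λ k → Walk E k (inj₁ x) (inj₂ y)) (+-suc a b)
      (_++_ E (lift₁ xz) (step ≈-refl (lift₂ (proj₁
        (Equivalence.from (G₂-isometric (z , z∈₂) y b) zy-geodesic)))))
    where
    zy-geodesic : IsDistance G z (proj₁ y) b
    zy-geodesic = zy , λ m v → +-cancelˡ-≤ a b m
      (least (a + m) (_++_ G (walk-map {G = G₁.graph} {G} G₁.inclusion G₁.InE⇒~ xz) v))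

  lift : ∀ {d} u v → IsDistance G (π u) (π v) d → Walk E (cross u v + d) u v
  lift (inj₁ x) (inj₁ y) d = lift₁ (proj₁ (Equivalence.from (G₁-isometric x y _) d))
  lift (inj₁ x) (inj₂ y) d = lift₁₂ x y d
  lift (inj₂ x) (inj₁ y) d = reverse E (lift₁₂ y x (distance-sym G d))
  lift (inj₂ x) (inj₂ y) d = lift₂ (proj₁ (Equivalence.from (G₂-isometric x y _) d))

  -- `lift` gives the upper bound. For the lower one, a walk in the expansion projects to a walk in
  -- `G` that saves at least `cross u v` steps.
  distance-lift : ∀ {d} u v → IsDistance G (π u) (π v) d → IsDistance E u v (cross u v + d)
  distance-lift u v isDist@(_ , least) = lift u v isDist , λ n w →
    let (m , p , m≤) = project u v w
    in ≤-trans (+-monoʳ-≤ (cross u v) (least m p)) m≤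

  -- G is not yet known to have distances here; those that ¬¬-exist suffice to
  -- derive the decidable inequality k ≤ cross u v + m.
  distance-project : ∀ {k} u v → IsDistance E u v k →
    ∃ λ d → k ≡ cross u v + d × IsDistance G (π u) (π v) d
  distance-project {k} u v (w , least) =
    let (d , p , d≤) = project u v w
        k≡           = ≤-antisym (bound p) d≤
    in d , k≡ , p , λ m q → +-cancelˡ-≤ (cross u v) d m (subst (_≤ cross u v + m) k≡ (bound q))
    where
    bound : ∀ {m} → Walk G m (π u) (π v) → k ≤ cross u v + m
    bound {m} q = decidable-stable (k ≤? cross u v + m) λ k≰ →
      ¬¬distance G q λ (d , isDist) →
        k≰ (≤-trans (least _ (lift u v isDist)) (+-monoʳ-≤ (cross u v) (proj₂ isDist m q)))

  -- Embedding the expansion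

  expansion-isPartialCube : IsPartialCube G → IsPartialCube E
  expansion-isPartialCube (X , f , f-isometric) =
    X+1 , f+side , common-distance⇒isometric f+side λ u v →
      -- A size computed in the hypercube is pulled back along `f` to a distance in `G`, so no
      -- shortest walk has to be searched for.
      let (n , pq) = Δ-finite (f ⟨$⟩ π u) (f ⟨$⟩ π v)
      in cross u v + n
       , distance-lift u v (Equivalence.from (f-isometric _ _ n) (size⇒distance _ _ pq))
       , size⇒distance (f+side ⟨$⟩ u) (f+side ⟨$⟩ v)
           (Enumeration-resp (extend-Δ _ _ (side u) (side v)) (extend-size _ pq))
    where
    f+side : Func (Graph.vertices E) (Graph.vertices (Hypercube (X+1 {X = X})))
    f+side = record
      { to   = λ u → extend (proj₁ (f ⟨$⟩ π u)) (side u) , _ ,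
                     Enumeration⇒HasSize (extend-size (side u) (enumerate (f ⟨$⟩ π u)))
      ; cong = λ { (inj₁ x≈y) (inj₁ a) → Func.cong f x≈y a
                 ; (inj₁ _)   (inj₂ _) → refl
                 ; (inj₂ x≈y) (inj₁ a) → Func.cong f x≈y a
                 ; (inj₂ _)   (inj₂ _) → refl }
      }

  -- Embedding the contraction

  module _ {X : Setoid ℓ ℓ} (f : Func (Graph.vertices E) (Graph.vertices (Hypercube X)))
    (f-isometric : IsIsometric E (Hypercube X) f)
    {z : V} (z∈₁ : G₁.InV z) (z∈₂ : G₂.InV z) where

    F : W → Subset X
    F u = proj₁ (f ⟨$⟩ u)

    corner : Bool → W
    corner false = inj₁ (z , z∈₁)
    corner true  = inj₂ (z , z∈₂)

    F-size : ∀ {d} u v → IsDistance G (π u) (π v) d → Enumeration (F u Δ F v) (cross u v + d)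
    F-size u v isDist = distance⇒size (f ⟨$⟩ u) (f ⟨$⟩ v)
      (Equivalence.to (f-isometric u v _) (distance-lift u v isDist))

    -- The hypercube supplies an exact distance for the images, `f` makes it one in the expansion,
    -- and projecting it gives one in `G`.
    distance-exists : ∀ u v → ∃ (IsDistance G (π u) (π v))
    distance-exists u v =
      let (n , pq)         = Δ-finite (f ⟨$⟩ u) (f ⟨$⟩ v)
          (d , _ , isDist) = distance-project u v
            (Equivalence.from (f-isometric u v n) (size⇒distance _ _ pq))
      in d , isDist

    corner-size : ∀ b c → Enumeration (F (corner b) Δ F (corner c)) (bit (b xor c))
    corner-size false false = F-size _ _ (distance-refl G ≈-refl)
    corner-size false true  = F-size _ _ (distance-refl G ≈-refl)
    corner-size true  false = F-size _ _ (distance-refl G ≈-refl)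
    corner-size true  true  = F-size _ _ (distance-refl G ≈-refl)

    -- Let a be the element in which F x¹ and F x² differ.  Toggling a turns
    -- F x¹ Δ F z¹, of size d, into F x² Δ F z¹, of size d + 1, so a is not in
    -- F x¹ Δ F z¹; likewise a is not in F x² Δ F z².  Hence a ∈ F z¹ Δ F z².
    crossing-edges-parallel : ∀ {x y} (x∈₁ : G₁.InV x) (y∈₂ : G₂.InV y) → x ≈ y →
      (F (inj₁ (x , x∈₁)) Δ F (inj₂ (y , y∈₂))) ≐ (F (corner false) Δ F (corner true))
    crossing-edges-parallel {x} {y} x∈₁ y∈₂ x≈y =
      singleton-≐ ab (corner-size false true)
        (xor-square (A ⟨$⟩ a) (B ⟨$⟩ a) (C ⟨$⟩ a) (D ⟨$⟩ a) (the∈ ab) a∉AΔC a∉BΔD)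
      where
      open xor-∧-Solver
      u v : W
      u = inj₁ (x , x∈₁)
      v = inj₂ (y , y∈₂)
      A B C D : Subset X
      A = F u
      B = F v
      C = F (corner false)
      D = F (corner true)
      xz : ∃ (IsDistance G x z)
      xz = distance-exists u (corner false)
      yz : IsDistance G y z (proj₁ xz)
      yz = distance-resp G x≈y ≈-refl (proj₂ xz)
      ab : Enumeration (A Δ B) 1
      ab = F-size u v (distance-refl G x≈y)
      a : Setoid.Carrier X
      a = the ab
      a∉AΔC : ¬ a ∈ (A Δ C)
      a∉AΔC = toggle-grows⇒∉ (F-size u (corner false) (proj₂ xz)) ab
        (Enumeration-resp (λ t → solve 3 (λ a b c → b :+ c := (a :+ c) :+ (a :+ b)) refl
          (A ⟨$⟩ t) (B ⟨$⟩ t) (C ⟨$⟩ t)) (F-size v (corner false) yz))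
      a∉BΔD : ¬ a ∈ (B Δ D)
      a∉BΔD = toggle-grows⇒∉ (F-size v (corner true) yz) ab
        (Enumeration-resp (λ t → solve 3 (λ a b d → a :+ d := (b :+ d) :+ (a :+ b)) refl
          (A ⟨$⟩ t) (B ⟨$⟩ t) (D ⟨$⟩ t)) (F-size u (corner true) (proj₂ xz)))

    h : W → FiniteSubset X
    h u = F u Δ F (corner (side u)) , _ ,
          Enumeration⇒HasSize (proj₂ (Δ-finite (f ⟨$⟩ u) (f ⟨$⟩ corner (side u))))

    -- On one side the base point is the same. Across sides, parallelism `F u Δ F v = F z¹ Δ F z²`
    -- rearranges to `F u Δ F z¹ = F v Δ F z²`.
    h-cong : ∀ u v → π u ≈ π v → proj₁ (h u) ≐ proj₁ (h v)
    h-cong (inj₁ _) (inj₁ _) x≈y a = cong (_xor (F (corner false) ⟨$⟩ a)) (Func.cong f (inj₁ x≈y) a)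
    h-cong (inj₂ _) (inj₂ _) x≈y a = cong (_xor (F (corner true) ⟨$⟩ a)) (Func.cong f (inj₂ x≈y) a)
    h-cong (inj₁ (x , x∈₁)) (inj₂ (y , y∈₂)) x≈y a =
      xor-exchange (F (inj₁ (x , x∈₁)) ⟨$⟩ a) _ _ _ (crossing-edges-parallel x∈₁ y∈₂ x≈y a)
    h-cong (inj₂ (x , x∈₂)) (inj₁ (y , y∈₁)) x≈y a = ≡.sym
      (xor-exchange (F (inj₁ (y , y∈₁)) ⟨$⟩ a) _ _ _ (crossing-edges-parallel y∈₁ x∈₂ (≈-sym x≈y) a))

    -- With both ends on one side the common base point cancels, leaving `F u Δ F v`.
    h-edge : ∀ u v → side u ≡ side v → Graph._~_ E u v → Enumeration (proj₁ (h u) Δ proj₁ (h v)) 1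
    h-edge u v same u~v = Enumeration-resp F≐h
      (distance⇒size (f ⟨$⟩ u) (f ⟨$⟩ v)
        (Equivalence.to (f-isometric u v 1) (distance-edge E {u} {v} u~v)))
      where
      open xor-∧-Solver
      F≐h : (F u Δ F v) ≐ (proj₁ (h u) Δ proj₁ (h v))
      F≐h a rewrite same =
        solve 3 (λ p q c → p :+ q := (p :+ c) :+ (q :+ c)) refl
          (F u ⟨$⟩ a) (F v ⟨$⟩ a) (F (corner (side v)) ⟨$⟩ a)

    -- An arbitrary choice of copy, which may send equal vertices to different sides. `g` is still
    -- well defined because `h` depends only on the projection.
    section : V → W
    section x with proj₁ G=G₁∪G₂ x
    ... | inj₁ x∈₁ = inj₁ (x , x∈₁)
    ... | inj₂ x∈₂ = inj₂ (x , x∈₂)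

    π-section : ∀ x → π (section x) ≡ x
    π-section x with proj₁ G=G₁∪G₂ x
    ... | inj₁ _ = refl
    ... | inj₂ _ = refl

    section-≈ : ∀ u → π (section (π u)) ≈ π u
    section-≈ u = reflexive (π-section (π u))

    g : Func vertices (Graph.vertices (Hypercube X))
    g = record
      { to   = h ∘ section
      ; cong = λ {x} {y} x≈y → h-cong (section x) (section y)
          (trans (reflexive (π-section x)) (trans x≈y (≈-sym (reflexive (π-section y)))))
      }

    -- `section` may place the ends of an edge on different sides. By `h-cong` its choices can be
    -- exchanged for the ends of a lift that stays on one side.
    g-lifted-edge : ∀ u v → side u ≡ side v → Graph._~_ E u v →
      Graph._~_ (Hypercube X) (g ⟨$⟩ π u) (g ⟨$⟩ π v)
    g-lifted-edge u v same u~v =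
      Enumeration⇒HasSize {P = proj₁ (g ⟨$⟩ π u) Δ proj₁ (g ⟨$⟩ π v)}
        (Enumeration-resp (λ a → ≡.sym (≡.cong₂ _xor_
            (h-cong (section (π u)) u (section-≈ u) a)
            (h-cong (section (π v)) v (section-≈ v) a)))
          (h-edge u v same u~v))

    g-edge : ∀ {x y} → x ~ y → Graph._~_ (Hypercube X) (g ⟨$⟩ x) (g ⟨$⟩ y)
    g-edge {x} {y} x~y with proj₂ G=G₁∪G₂ x y x~y
    ... | inj₁ e = g-lifted-edge (inj₁ (x , G₁.source e)) (inj₁ (y , G₁.target e)) refl e
    ... | inj₂ e = g-lifted-edge (inj₂ (x , G₂.source e)) (inj₂ (y , G₂.target e)) refl e

    -- Adding the difference of the base points, of size `cross u v`, turns `h u Δ h v` into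
    -- `F u Δ F v`, of size `cross u v + d`. Subadditivity and cancellation leave `d ≤ n`.
    distance≤h-size : ∀ {d n} u v → IsDistance G (π u) (π v) d →
      Enumeration (proj₁ (h u) Δ proj₁ (h v)) n → d ≤ n
    distance≤h-size {d} {n} u v isDist hh =
      let (k , k≤ , uv) = Δ-size hh (corner-size (side u) (side v))
      in +-cancelˡ-≤ (cross u v) d n (begin
        cross u v + d ≡⟨ size-unique (F-size u v isDist) (Enumeration-resp h-corners≐F uv) ⟩
        k             ≤⟨ k≤ ⟩
        n + cross u v ≡⟨ +-comm n (cross u v) ⟩
        cross u v + n ∎)
      where
      open ≤-Reasoning
      open xor-∧-Solver
      Cu Cv : Subset X
      Cu = F (corner (side u))
      Cv = F (corner (side v))
      h-corners≐F : ((proj₁ (h u) Δ proj₁ (h v)) Δ (Cu Δ Cv)) ≐ (F u Δ F v)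
      h-corners≐F a = solve 4
        (λ p q c d → ((p :+ c) :+ (q :+ d)) :+ (c :+ d) := p :+ q) refl
        (F u ⟨$⟩ a) (F v ⟨$⟩ a) (Cu ⟨$⟩ a) (Cv ⟨$⟩ a)

    g-isometric : IsIsometric G (Hypercube X) g
    g-isometric = common-distance⇒isometric {G = G} {Hypercube X} g λ x y →
      let u          = section x
          v          = section y
          (d , d-uv) = distance-exists u v
          d-xy       = distance-resp G (reflexive (π-section x)) (reflexive (π-section y)) d-uv
          (n , gg)   = Δ-finite (h u) (h v)
          -- `g` maps edges to edges, so a geodesic of `G` becomes a walk of the same length.
          n≤d        = walk⇒size≤ (h u) (h v)
                         (walk-map {G = G} {Hypercube X} g g-edge (proj₁ d-xy)) gg
          d≡n        = ≤-antisym (distance≤h-size u v d-uv gg) n≤d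
      in d , d-xy , size⇒distance (h u) (h v) (subst (Enumeration _) (≡.sym d≡n) gg)

  contraction-isPartialCube : Connected G → IsPartialCube E → IsPartialCube G
  contraction-isPartialCube connected (X , f , f-isometric) =
    let (x , x∈₁) = G₁.nonempty
        (y , y∈₂) = G₂.nonempty
        -- Connectedness joins `V₁` to `V₂` by a walk, and its crossing is the base point.
        (z , _ , _ , z∈₁ , z∈₂ , _) = crossing (proj₂ (connected x y)) x∈₁ y∈₂
    in X , g f f-isometric z∈₁ z∈₂ , g-isometric f f-isometric z∈₁ z∈₂

theorem8p3 : ∀ {ℓ : Level} (G G′ : Graph ℓ) →
    (IsPartialCube G → G′ IsExpansionOf G → IsPartialCube G′) ×
    (IsPartialCube G′ → G IsContractionOf G′ → IsPartialCube G)
theorem8p3 G G′ =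
    (λ cube (_ , G₁ , G₂ , iso₁ , iso₂ , G=G₁∪G₂ , G′≅E) →
      IsPartialCube-resp-≅ {G = G′} {expansion G G₁ G₂} G′≅E
        (Expansion.expansion-isPartialCube G₁ G₂ iso₁ iso₂ G=G₁∪G₂ cube))
  , (λ cube (connected , G₁ , G₂ , iso₁ , iso₂ , G=G₁∪G₂ , G′≅E) →
      Expansion.contraction-isPartialCube G₁ G₂ iso₁ iso₂ G=G₁∪G₂ connected
        (IsPartialCube-resp-≅ {G = expansion G G₁ G₂} {G′}
          (≅-sym {G = G′} {expansion G G₁ G₂} G′≅E) cube))
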